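{- For every rooted tree $T$, \[\mathcal{P}(T;x,y)=L(T;x,y):=\sum_{A\in\mathcal{A}(T)}x^{\ell(A)}y^{s(A)}.\]
   Context: For a rooted tree $T$ with root $r$, the branches $T_1,\dots,T_k$ are the subtrees obtained by deleting $r$, each rooted at the neighbour of $r$ it contains; $|T|$ is the number of vertices. The polynomial $\mathcal{P}(T;x,y)$ is defined recursively by $\mathcal{P}(T;x,y)=x$ if $T$ has a single vertex, and otherwise $\mathcal{P}(T;x,y)=\prod_{i=1}^k\mathcal{P}(T_i;x,y)+y^{|T|-1}$. An antichain in $T$ is a set of vertices no two of which lie on a common path starting at the root (i.e. no one is an ancestor of another); a maximal antichain is an antichain not properly contained in another antichain; $\mathcal{A}(T)$ is the set of maximal antichains of $T$. A leaf is a vertex with no children (so the root of a one-vertex tree is a leaf). For $A\in\mathcal{A}(T)$, $\ell(A)$ is the number of leaves in $A$, and $s(A)=\sum_{a\in A}(|T_a|-1)$, where $T_a$ is the subtree consisting of $a$ and all its descendants. -}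

module Defs where

open import Data.Bool using (if_then_else_)
open import Data.Fin using (Fin)
open import Data.Fin.Properties using (all?) renaming (_≟_ to _≟ᶠ_)
open import Data.Fin.Subset using (Subset; inside; outside; _∈_; _⊂_)
open import Data.Fin.Subset.Properties using (_∈?_; _⊂?_; anySubset?)
open import Data.Integer using (ℤ; 0ℤ; 1ℤ) renaming (_+_ to _+ᶻ_; _*_ to _*ᶻ_)
open import Data.List using (List; []; _∷_; _++_; map; length; filter; lookup; foldr; sum; allFin; cartesianProductWith)
open import Data.List.Membership.Propositional using () renaming (_∈_ to _∈ˡ_)
open import Data.List.Membership.Propositional.Properties using (∈-map⁺; ∈-map⁻; ∈-++⁺ˡ; ∈-++⁺ʳ)
open import Data.List.Relation.Unary.All as All using ()
import Data.List.Relation.Unary.All.Properties as Allₚ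
open import Data.List.Relation.Unary.AllPairs using ([]; _∷_)
open import Data.List.Relation.Unary.Any using (Any; here; there)
open import Data.List.Relation.Unary.Unique.Propositional using (Unique)
open import Data.List.Relation.Unary.Unique.Propositional.Properties using (map⁺; ++⁺)
open import Data.Nat using (ℕ; zero; suc; _+_; _∸_; _≡ᵇ_)
open import Data.Product using (_×_; _,_)
import Data.Vec as Vec
open import Relation.Binary.PropositionalEquality using (_≡_; _≢_; refl)
open import Relation.Nullary using (¬_; Dec; yes; no)
open import Relation.Nullary.Decidable using (map′; ¬?; _×-dec_; _→-dec_)

-- Polynomials in ℤ[x,y]: (c , i , j) stands for the monomial c xⁱ yʲ.
Term : Set
Term = ℤ × ℕ × ℕ

-- A finite formal sum of terms; the same exponents may occur repeatedly, so
-- polynomials are compared with _≈_ below and not with _≡_.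
Poly : Set
Poly = List Term

coeff : Poly → ℕ → ℕ → ℤ
coeff []                 i j = 0ℤ
coeff ((c , k , l) ∷ p) i j =
  (if k ≡ᵇ i then (if l ≡ᵇ j then c else 0ℤ) else 0ℤ) +ᶻ coeff p i j

infix 4 _≈_
_≈_ : Poly → Poly → Set
p ≈ q = ∀ i j → coeff p i j ≡ coeff q i j

infixl 6 _⊕_
infixl 7 _⊗_
infixr 8 _^_

𝟘 𝟙 X Y : Poly
𝟘 = []
𝟙 = (1ℤ , 0 , 0) ∷ []
X = (1ℤ , 1 , 0) ∷ []
Y = (1ℤ , 0 , 1) ∷ []

_⊕_ : Poly → Poly → Poly
_⊕_ = _++_

_·ᵗ_ : Term → Term → Term
(c , i , j) ·ᵗ (d , k , l) = c *ᶻ d , i + k , j + l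

_⊗_ : Poly → Poly → Poly
_⊗_ = cartesianProductWith _·ᵗ_

_^_ : Poly → ℕ → Poly
p ^ zero  = 𝟙
p ^ suc n = p ⊗ p ^ n

⨁ : List Poly → Poly
⨁ = foldr _⊕_ 𝟘

-- A finite rooted tree is given by the list of its branches. The order in which
-- they are listed carries no meaning: it affects 𝓟 and L only up to _≈_.
data Tree : Set where
  node : List Tree → Tree

data Vertex : Tree → Set where
  root  : ∀ {ts} → Vertex (node ts)
  below : ∀ {ts} → Any Vertex ts → Vertex (node ts)

mutual
  vertices : (T : Tree) → List (Vertex T)
  vertices (node ts) = root ∷ map below (forestVertices ts)

  forestVertices : (ts : List Tree) → List (Any Vertex ts)
  forestVertices []       = []
  forestVertices (t ∷ ts) =
    map here (vertices t) ++ map there (forestVertices ts)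

∣_∣ : Tree → ℕ
∣ T ∣ = length (vertices T)

mutual
  subtree : ∀ {T} → Vertex T → Tree
  subtree {T} root      = T
  subtree     (below v) = forestSubtree v

  forestSubtree : ∀ {ts} → Any Vertex ts → Tree
  forestSubtree (here v)  = subtree v
  forestSubtree (there v) = forestSubtree v

IsLeaf : ∀ {T} → Vertex T → Set
IsLeaf v = subtree v ≡ node []

-- u ≼ v: the path from the root to v passes through u, i.e. u is v itself or
-- an ancestor of v.
infix 4 _≼_ _≼ᶠ_
mutual
  data _≼_ : ∀ {T} → Vertex T → Vertex T → Set where
    root≼  : ∀ {ts} {v : Vertex (node ts)} → root ≼ v
    below≼ : ∀ {ts} {u v : Any Vertex ts} → u ≼ᶠ v → below u ≼ below v

  data _≼ᶠ_ : ∀ {ts} → Any Vertex ts → Any Vertex ts → Set where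
    here≼  : ∀ {t ts} {u v : Vertex t} →
             u ≼ v → _≼ᶠ_ {t ∷ ts} (here u) (here v)
    there≼ : ∀ {t ts} {u v : Any Vertex ts} →
             u ≼ᶠ v → _≼ᶠ_ {t ∷ ts} (there u) (there v)

mutual
  𝓟 : Tree → Poly
  𝓟 (node [])          = X
  𝓟 T@(node (t ∷ ts)) = ∏𝓟 (t ∷ ts) ⊕ Y ^ (∣ T ∣ ∸ 1)

  ∏𝓟 : List Tree → Poly
  ∏𝓟 []       = 𝟙
  ∏𝓟 (t ∷ ts) = 𝓟 t ⊗ ∏𝓟 ts

mutual
  ∈-vertices : ∀ {T} (v : Vertex T) → v ∈ˡ vertices T
  ∈-vertices root      = here refl
  ∈-vertices (below v) = there (∈-map⁺ below (∈-forestVertices v))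

  ∈-forestVertices : ∀ {ts} (v : Any Vertex ts) → v ∈ˡ forestVertices ts
  ∈-forestVertices (here v)  = ∈-++⁺ˡ (∈-map⁺ here (∈-vertices v))
  ∈-forestVertices {t ∷ _} (there v) =
    ∈-++⁺ʳ (map here (vertices t)) (∈-map⁺ there (∈-forestVertices v))

mutual
  vertices-unique : ∀ T → Unique (vertices T)
  vertices-unique (node ts) =
    Allₚ.map⁺ (All.universal (λ _ ()) (forestVertices ts))
    ∷ map⁺ (λ { refl → refl }) (forestVertices-unique ts)

  forestVertices-unique : ∀ ts → Unique (forestVertices ts)
  forestVertices-unique []       = []
  forestVertices-unique (t ∷ ts) =
    ++⁺ (map⁺ (λ { refl → refl }) (vertices-unique t))
        (map⁺ (λ { refl → refl }) (forestVertices-unique ts))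
        disjoint
    where
    disjoint : ∀ {v} → ¬ (v ∈ˡ map here (vertices t)
                        × v ∈ˡ map there (forestVertices ts))
    disjoint (p , q) with ∈-map⁻ here p | ∈-map⁻ there q
    ... | _ , _ , refl | _ , _ , ()

-- Position i in a set A : VertexSet T refers to the i-th entry of vertices T.
VertexSet : Tree → Set
VertexSet T = Subset ∣ T ∣

vertex : (T : Tree) → Fin ∣ T ∣ → Vertex T
vertex T = lookup (vertices T)

members : (T : Tree) → VertexSet T → List (Vertex T)
members T A = map (vertex T) (filter (_∈? A) (allFin ∣ T ∣))

IsAntichain : (T : Tree) → VertexSet T → Set
IsAntichain T A =
  ∀ i j → i ∈ A → j ∈ A → i ≢ j → ¬ (vertex T i ≼ vertex T j)

IsMaximalAntichain : (T : Tree) → VertexSet T → Set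
IsMaximalAntichain T A =
  IsAntichain T A × (∀ B → IsAntichain T B → ¬ (A ⊂ B))

mutual
  _≼?_ : ∀ {T} (u v : Vertex T) → Dec (u ≼ v)
  root    ≼? _       = yes root≼
  below _ ≼? root    = no λ ()
  below u ≼? below v = map′ below≼ (λ { (below≼ p) → p }) (u ≼ᶠ? v)

  _≼ᶠ?_ : ∀ {ts} (u v : Any Vertex ts) → Dec (u ≼ᶠ v)
  here u  ≼ᶠ? here v  = map′ here≼ (λ { (here≼ p) → p }) (u ≼? v)
  here _  ≼ᶠ? there _ = no λ ()
  there _ ≼ᶠ? here _  = no λ ()
  there u ≼ᶠ? there v = map′ there≼ (λ { (there≼ p) → p }) (u ≼ᶠ? v)

isLeaf? : ∀ {T} (v : Vertex T) → Dec (IsLeaf v)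
isLeaf? v with subtree v
... | node []      = yes refl
... | node (_ ∷ _) = no λ ()

isAntichain? : ∀ T A → Dec (IsAntichain T A)
isAntichain? T A = all? λ i → all? λ j →
  (i ∈? A) →-dec ((j ∈? A) →-dec (¬? (i ≟ᶠ j) →-dec ¬? (vertex T i ≼? vertex T j)))

isMaximalAntichain? : ∀ T A → Dec (IsMaximalAntichain T A)
isMaximalAntichain? T A = isAntichain? T A ×-dec
  map′ (λ ¬∃ B acB A⊂B → ¬∃ (B , acB , A⊂B))
       (λ { max (B , acB , A⊂B) → max B acB A⊂B })
       (¬? (anySubset? λ B → isAntichain? T B ×-dec (A ⊂? B)))

subsets : (n : ℕ) → List (Subset n)
subsets zero    = Vec.[] ∷ []
subsets (suc n) =
  map (outside Vec.∷_) (subsets n) ++ map (inside Vec.∷_) (subsets n)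

∈-subsets : ∀ {n} (A : Subset n) → A ∈ˡ subsets n
∈-subsets Vec.[]                     = here refl
∈-subsets (outside Vec.∷ A)          = ∈-++⁺ˡ (∈-map⁺ (outside Vec.∷_) (∈-subsets A))
∈-subsets {suc n} (inside Vec.∷ A) =
  ∈-++⁺ʳ (map (outside Vec.∷_) (subsets n)) (∈-map⁺ (inside Vec.∷_) (∈-subsets A))

subsets-unique : ∀ n → Unique (subsets n)
subsets-unique zero    = All.[] ∷ []
subsets-unique (suc n) =
  ++⁺ (map⁺ (λ { refl → refl }) (subsets-unique n))
      (map⁺ (λ { refl → refl }) (subsets-unique n))
      disjoint
  where
  disjoint : ∀ {A} → ¬ (A ∈ˡ map (outside Vec.∷_) (subsets n)
                      × A ∈ˡ map (inside Vec.∷_) (subsets n))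
  disjoint (p , q) with ∈-map⁻ (outside Vec.∷_) p | ∈-map⁻ (inside Vec.∷_) q
  ... | _ , _ , refl | _ , _ , ()

𝓐 : (T : Tree) → List (VertexSet T)
𝓐 T = filter (isMaximalAntichain? T) (subsets ∣ T ∣)

ℓ : (T : Tree) → VertexSet T → ℕ
ℓ T A = length (filter isLeaf? (members T A))

s : (T : Tree) → VertexSet T → ℕ
s T A = sum (map (λ a → ∣ subtree a ∣ ∸ 1) (members T A))

L : Tree → Poly
L T = ⨁ (map (λ A → X ^ ℓ T A ⊗ Y ^ s T A) (𝓐 T))

{-# OPTIONS --safe #-}
module Submission where

-- A maximal antichain of T is either {r}, contributing y^(|T|-1) (or x when r is
-- a leaf), or a union of maximal antichains of the branches, one for each branch;
-- since ℓ and s are additive over such a union, L satisfies the recursion of 𝓟.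
-- List the vertex sets as sublists of the list of vertices. In this
-- enumeration the sets avoiding the root come first, and those of a forest form a
-- Cartesian product over the branches, so 𝓟 T and L T agree term by term.

open import Defs
open import Data.Empty using (⊥-elim)
open import Data.Fin using (Fin; suc)
open import Data.Fin.Subset using (Subset; inside; outside; ⁅_⁆; _∪_; _∈_; _⊂_)
open import Data.Fin.Subset.Properties using (_∈?_; drop-there; x∈⁅x⁆; x∈⁅y⁆⇒x≡y; p⊆p∪q; q⊆p∪q; x∈p∪q⁻)
open import Data.Integer using (1ℤ)
open import Data.List using (List; []; _∷_; _++_; map; length; filter; lookup; tabulate; allFin; cartesianProductWith)
open import Data.List.Membership.Propositional using (find; lose) renaming (_∈_ to _∈ˡ_)
open import Data.List.Membership.Propositional.Properties using (∈-map⁺; ∈-map⁻; ∈-filter⁺; ∈-filter⁻; ∈-allFin)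
open import Data.List.Properties using (map-∘; map-id; map-cong; map-++; ++-identityʳ; length-map; filter-accept; map-tabulate; length-++; filter-++; filter-none; filter-≐; cartesianProductWith-distribʳ-++)
open import Data.List.Relation.Unary.All as All using (All; []; _∷_)
import Data.List.Relation.Unary.All.Properties as All
open import Data.List.Relation.Unary.AllPairs as AllPairs using (AllPairs; []; _∷_; allPairs?)
import Data.List.Relation.Unary.AllPairs.Properties as AllPairs
open import Data.List.Relation.Unary.Any as Any using (Any; here; there)
import Data.List.Relation.Unary.Any.Properties as Any
open import Data.List.Relation.Unary.Unique.Propositional using (Unique)
import Data.List.Relation.Unary.Unique.Propositional.Properties as Unique
open import Data.Nat using (ℕ; zero; suc; _+_; _∸_)
open import Data.Nat.ListAction using (sum)
open import Data.Nat.ListAction.Properties using (sum-++)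
open import Data.Nat.Properties using (+-identityʳ)
open import Data.Product using (_×_; _,_; proj₁; proj₂)
open import Data.Sum as Sum using (_⊎_; inj₁; inj₂; swap)
import Data.Vec as Vec
open import Function using (_∘_; _on_)
open import Relation.Binary.Core using (Rel)
open import Relation.Binary.Definitions using (Symmetric) renaming (Decidable to Decidable₂)
open import Relation.Binary.PropositionalEquality using (_≡_; _≢_; refl; sym; trans; cong; cong₂; subst; module ≡-Reasoning)
open import Relation.Nullary using (¬_; Dec; yes; no; contradiction)
open import Relation.Nullary.Decidable using (map′; ¬?; _×-dec_; _⊎-dec_)
open import Relation.Unary using (Pred; Decidable; _≐_)
open import Level using (0ℓ)

open ≡-Reasoning

private
  variable
    A B C D E F : Set

-- Lists

map-filter : {P : Pred A 0ℓ} {Q : Pred B 0ℓ} (P? : Decidable P) (Q? : Decidable Q)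
             (f : A → B) → P ≐ Q ∘ f →
             ∀ xs → map f (filter P? xs) ≡ filter Q? (map f xs)
map-filter P? Q? f P≐Q []       = refl
map-filter P? Q? f P≐Q (x ∷ xs) with P? x | Q? (f x)
... | yes _  | yes _  = cong (f x ∷_) (map-filter P? Q? f P≐Q xs)
... | yes px | no ¬qx = contradiction (proj₁ P≐Q px) ¬qx
... | no ¬px | yes qx = contradiction (proj₂ P≐Q qx) ¬px
... | no _   | no _   = map-filter P? Q? f P≐Q xs

-- If `P x` fails, `R` rejects the whole row of `x`; if it holds, `R ∘ f x` accepts the same `y` as
-- `Q`. Filtering therefore acts row by row and keeps the order.
filter-cartesianProductWith :
  {P : Pred A 0ℓ} {Q : Pred B 0ℓ} {R : Pred C 0ℓ}
  (P? : Decidable P) (Q? : Decidable Q) (R? : Decidable R) (f : A → B → C) →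
  (∀ {x y} → R (f x y) → P x × Q y) → (∀ {x y} → P x → Q y → R (f x y)) →
  ∀ xs ys → filter R? (cartesianProductWith f xs ys)
            ≡ cartesianProductWith f (filter P? xs) (filter Q? ys)
filter-cartesianProductWith P? Q? R? f to from []       ys = refl
filter-cartesianProductWith P? Q? R? f to from (x ∷ xs) ys
  rewrite filter-++ R? (map (f x) ys) (cartesianProductWith f xs ys)
        | filter-cartesianProductWith P? Q? R? f to from xs ys
  with P? x
... | yes px = cong (_++ _) (sym (map-filter Q? R? (f x) (from px , proj₂ ∘ to) ys))
... | no ¬px = cong (_++ _) (filter-none R? (All.map⁺ (All.universal (λ _ → ¬px ∘ proj₁ ∘ to) ys)))

map-cartesianProductWith :
  (f : A → B → C) (g : D → E → F) (h : C → F) (i : A → D) (j : B → E) →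
  (∀ x y → h (f x y) ≡ g (i x) (j y)) →
  ∀ xs ys → map h (cartesianProductWith f xs ys) ≡ cartesianProductWith g (map i xs) (map j ys)
map-cartesianProductWith f g h i j eq []       ys = refl
map-cartesianProductWith f g h i j eq (x ∷ xs) ys = begin
  map h (map (f x) ys ++ cartesianProductWith f xs ys)
    ≡⟨ map-++ h (map (f x) ys) _ ⟩
  map h (map (f x) ys) ++ map h (cartesianProductWith f xs ys)
    ≡⟨ cong₂ _++_ (row ys) (map-cartesianProductWith f g h i j eq xs ys) ⟩
  map (g (i x)) (map j ys) ++ cartesianProductWith g (map i xs) (map j ys) ∎
  where
  row : ∀ zs → map h (map (f x) zs) ≡ map (g (i x)) (map j zs)
  row []       = refl
  row (z ∷ zs) = cong₂ _∷_ (eq x z) (row zs)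

module _ {R : Rel A 0ℓ} where

  AllPairs-++⁻ : ∀ xs {ys} → AllPairs R (xs ++ ys) → AllPairs R xs × AllPairs R ys
  AllPairs-++⁻ []       rs       = [] , rs
  AllPairs-++⁻ (x ∷ xs) (r ∷ rs) with AllPairs-++⁻ xs rs
  ... | rxs , rys = All.++⁻ˡ xs r ∷ rxs , rys

  -- `AllPairs` relates an entry only to later ones; symmetry supplies the pairs met in the opposite
  -- order.
  AllPairs-lookup : Symmetric R → ∀ {xs x y} → AllPairs R xs →
                    x ∈ˡ xs → y ∈ˡ xs → x ≢ y → R x y
  AllPairs-lookup R-sym (r ∷ rs) (here refl) (here refl) x≢y = contradiction refl x≢y
  AllPairs-lookup R-sym (r ∷ rs) (here refl) (there y∈)  x≢y = All.lookup r y∈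
  AllPairs-lookup R-sym (r ∷ rs) (there x∈)  (here refl) x≢y = R-sym (All.lookup r x∈)
  AllPairs-lookup R-sym (r ∷ rs) (there x∈)  (there y∈)  x≢y = AllPairs-lookup R-sym rs x∈ y∈ x≢y

  AllPairs-unique : ∀ {xs} → Unique xs →
                    (∀ {x y} → x ∈ˡ xs → y ∈ˡ xs → x ≢ y → R x y) → AllPairs R xs
  AllPairs-unique []         r = []
  AllPairs-unique (x≢ ∷ xs!) r =
    All.tabulate (λ y∈ → r (here refl) (there y∈) (All.lookup x≢ y∈))
    ∷ AllPairs-unique xs! (λ x∈ y∈ → r (there x∈) (there y∈))

-- Sublists

-- The order matters: lists omitting `x` come first, as `outside` precedes `inside` in `subsets`.
-- Since the root heads `vertices`, the antichain of the root alone comes last, like the power of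
-- `Y` in `𝓟`.
sublists : List A → List (List A)
sublists []       = [] ∷ []
sublists (x ∷ xs) = sublists xs ++ map (x ∷_) (sublists xs)

sublists-map : (f : A → B) → ∀ xs → sublists (map f xs) ≡ map (map f) (sublists xs)
sublists-map f []       = refl
sublists-map f (x ∷ xs) = begin
  sublists (map f xs) ++ map (f x ∷_) (sublists (map f xs))
    ≡⟨ cong (λ S → S ++ map (f x ∷_) S) (sublists-map f xs) ⟩
  map (map f) (sublists xs) ++ map (f x ∷_) (map (map f) (sublists xs))
    ≡⟨ cong (map (map f) (sublists xs) ++_) (trans (sym (map-∘ (sublists xs))) (map-∘ (sublists xs))) ⟩
  map (map f) (sublists xs) ++ map (map f) (map (x ∷_) (sublists xs))
    ≡⟨ map-++ (map f) (sublists xs) _ ⟨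
  map (map f) (sublists (x ∷ xs)) ∎

-- In `sublists`, choices about earlier entries vary slowest, and so does the first factor of
-- `cartesianProductWith`; hence even the orders agree.
sublists-++ : (xs ys : List A) →
              sublists (xs ++ ys) ≡ cartesianProductWith _++_ (sublists xs) (sublists ys)
sublists-++ []       ys = begin
  sublists ys                   ≡⟨ map-id (sublists ys) ⟨
  map ([] ++_) (sublists ys)    ≡⟨ ++-identityʳ _ ⟨
  map ([] ++_) (sublists ys) ++ [] ∎
sublists-++ (x ∷ xs) ys = begin
  sublists (xs ++ ys) ++ map (x ∷_) (sublists (xs ++ ys))
    ≡⟨ cong (λ S → S ++ map (x ∷_) S) (sublists-++ xs ys) ⟩
  sublists xs ⊠ sublists ys ++ map (x ∷_) (sublists xs ⊠ sublists ys)
    ≡⟨ cong (sublists xs ⊠ sublists ys ++_)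
         (map-cartesianProductWith _++_ _++_ (x ∷_) (x ∷_) (λ z → z) (λ _ _ → refl) (sublists xs) (sublists ys)) ⟩
  sublists xs ⊠ sublists ys ++ map (x ∷_) (sublists xs) ⊠ map (λ z → z) (sublists ys)
    ≡⟨ cong (λ S → sublists xs ⊠ sublists ys ++ map (x ∷_) (sublists xs) ⊠ S) (map-id (sublists ys)) ⟩
  sublists xs ⊠ sublists ys ++ map (x ∷_) (sublists xs) ⊠ sublists ys
    ≡⟨ cartesianProductWith-distribʳ-++ _++_ (sublists xs) _ (sublists ys) ⟨
  sublists (x ∷ xs) ⊠ sublists ys ∎
  where
  infixr 6 _⊠_
  _⊠_ : List (List _) → List (List _) → List (List _)
  _⊠_ = cartesianProductWith _++_

-- Each entry adds only nonempty lists, all of which are rejected. The intended `P l` says that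
-- `root ∷ l` is maximal.
filter-sublists-[] : {P : Pred (List A) 0ℓ} (P? : Decidable P) →
                     P [] → (∀ {x xs} → ¬ P (x ∷ xs)) →
                     ∀ xs → filter P? (sublists xs) ≡ [] ∷ []
filter-sublists-[] P? p[] ¬p∷ [] = filter-accept P? p[]
filter-sublists-[] P? p[] ¬p∷ (x ∷ xs) = begin
  filter P? (sublists xs ++ map (x ∷_) (sublists xs))
    ≡⟨ filter-++ P? (sublists xs) _ ⟩
  filter P? (sublists xs) ++ filter P? (map (x ∷_) (sublists xs))
    ≡⟨ cong₂ _++_ (filter-sublists-[] P? p[] ¬p∷ xs)
         (filter-none P? (All.map⁺ (All.universal (λ _ → ¬p∷) (sublists xs)))) ⟩
  [] ∷ [] ∎

-- `members T` unfolds to `select (vertices T)`; allowing any list makes induction possible.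
select : (xs : List A) → Subset (length xs) → List A
select xs S = map (lookup xs) (filter (_∈? S) (allFin (length xs)))

-- As `allFin (suc n)` unfolds to a zero followed by `tabulate suc`, this is what is left of
-- `select (x ∷ xs) (b Vec.∷ S)` once position zero is decided.
select-tail : ∀ (x : A) xs b S →
              map (lookup (x ∷ xs)) (filter (_∈? (b Vec.∷ S)) (tabulate suc)) ≡ select xs S
select-tail x xs b S = begin
  map (lookup (x ∷ xs)) (filter (_∈? (b Vec.∷ S)) (tabulate suc))
    ≡⟨ cong (map (lookup (x ∷ xs)) ∘ filter (_∈? (b Vec.∷ S))) (map-tabulate (λ i → i) suc) ⟨
  map (lookup (x ∷ xs)) (filter (_∈? (b Vec.∷ S)) (map suc (allFin (length xs))))
    ≡⟨ cong (map (lookup (x ∷ xs)))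
         (map-filter (_∈? S) (_∈? (b Vec.∷ S)) suc (Vec.there , drop-there) (allFin (length xs))) ⟨
  map (lookup (x ∷ xs)) (map suc (filter (_∈? S) (allFin (length xs))))
    ≡⟨ map-∘ _ ⟨
  select xs S ∎

map-select-subsets : (xs : List A) → map (select xs) (subsets (length xs)) ≡ sublists xs
map-select-subsets []       = refl
map-select-subsets (x ∷ xs) = begin
  map (select (x ∷ xs)) (map (outside Vec.∷_) Ss ++ map (inside Vec.∷_) Ss)
    ≡⟨ map-++ (select (x ∷ xs)) (map (outside Vec.∷_) Ss) _ ⟩
  map (select (x ∷ xs)) (map (outside Vec.∷_) Ss) ++ map (select (x ∷ xs)) (map (inside Vec.∷_) Ss)
    ≡⟨ cong₂ _++_ (map-∘ Ss) (map-∘ Ss) ⟨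
  map (select (x ∷ xs) ∘ (outside Vec.∷_)) Ss ++ map (select (x ∷ xs) ∘ (inside Vec.∷_)) Ss
    ≡⟨ cong₂ _++_ (map-cong (select-tail x xs outside) Ss) (map-cong (cong (x ∷_) ∘ select-tail x xs inside) Ss) ⟩
  map (select xs) Ss ++ map ((x ∷_) ∘ select xs) Ss
    ≡⟨ cong (map (select xs) Ss ++_) (map-∘ Ss) ⟩
  map (select xs) Ss ++ map (x ∷_) (map (select xs) Ss)
    ≡⟨ cong (λ S → S ++ map (x ∷_) S) (map-select-subsets xs) ⟩
  sublists (x ∷ xs) ∎
  where
  Ss = subsets (length xs)

-- Maximal antichains

infix 4 _~_ _~ᶠ_ _~?_ _~ᶠ?_

_~_ : ∀ {T} → Rel (Vertex T) 0ℓ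
u ~ v = u ≼ v ⊎ v ≼ u

_~ᶠ_ : ∀ {ts} → Rel (Any Vertex ts) 0ℓ
u ~ᶠ v = u ≼ᶠ v ⊎ v ≼ᶠ u

_~?_ : ∀ {T} → Decidable₂ (_~_ {T})
u ~? v = (u ≼? v) ⊎-dec (v ≼? u)

_~ᶠ?_ : ∀ {ts} → Decidable₂ (_~ᶠ_ {ts})
u ~ᶠ? v = (u ≼ᶠ? v) ⊎-dec (v ≼ᶠ? u)

-- A symmetric relation _∼_ stands for comparability. An antichain is maximal
-- exactly when every vertex is comparable to one of its members.
Maximal : Rel A 0ℓ → Pred (List A) 0ℓ
Maximal _∼_ l = AllPairs (λ u v → ¬ u ∼ v) l × (∀ w → Any (w ∼_) l)

-- Covering quantifies over a type; the complete list `vs` makes it a finite check.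
maximal? : {_∼_ : Rel A 0ℓ} → Decidable₂ _∼_ → (vs : List A) → (∀ v → v ∈ˡ vs) →
           Decidable (Maximal _∼_)
maximal? _∼?_ vs complete l =
  allPairs? (λ u v → ¬? (u ∼? v)) l
  ×-dec map′ (λ cover w → All.lookup cover (complete w)) (λ cover → All.universal cover vs)
             (All.all? (λ w → Any.any? (w ∼?_) l) vs)

treeMaximal? : ∀ T → Decidable (Maximal (_~_ {T}))
treeMaximal? T = maximal? _~?_ (vertices T) ∈-vertices

forestMaximal? : ∀ ts → Decidable (Maximal (_~ᶠ_ {ts}))
forestMaximal? ts = maximal? _~ᶠ?_ (forestVertices ts) ∈-forestVertices

here~⁻ : ∀ {t ts} {u v : Vertex t} → here {xs = ts} u ~ᶠ here v → u ~ v
here~⁻ = Sum.map (λ { (here≼ p) → p }) (λ { (here≼ p) → p })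

there~⁻ : ∀ {t ts} {u v : Any Vertex ts} → there {x = t} u ~ᶠ there v → u ~ᶠ v
there~⁻ = Sum.map (λ { (there≼ p) → p }) (λ { (there≼ p) → p })

below~⁻ : ∀ {ts} {u v : Any Vertex ts} → below u ~ below v → u ~ᶠ v
below~⁻ = Sum.map (λ { (below≼ p) → p }) (λ { (below≼ p) → p })

here≁there : ∀ {t ts} {u : Vertex t} {v : Any Vertex ts} → ¬ (here u ~ᶠ there v)
here≁there (inj₁ ())
here≁there (inj₂ ())

join : ∀ {t ts} → List (Vertex t) → List (Any Vertex ts) → List (Any Vertex (t ∷ ts))
join a b = map here a ++ map there b

-- By `here≁there`, a member comparable to a vertex of the first branch lies in that branch, and
-- likewise for the remaining branches, so each part covers its own vertices.
maximal-join⁻ : ∀ {t ts} {a : List (Vertex t)} {b : List (Any Vertex ts)} →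
                Maximal _~ᶠ_ (join a b) → Maximal _~_ a × Maximal _~ᶠ_ b
maximal-join⁻ {t} {ts} {a} {b} (anti , cover) =
  ( AllPairs.map (_∘ Sum.map here≼ here≼) (AllPairs.map⁻ (proj₁ antis)) , coverˡ ) ,
  ( AllPairs.map (_∘ Sum.map there≼ there≼) (AllPairs.map⁻ (proj₂ antis)) , coverʳ )
  where
  antis = AllPairs-++⁻ (map here a) anti

  coverˡ : ∀ w → Any (w ~_) a
  coverˡ w with Any.++⁻ (map here a) (cover (here w))
  ... | inj₁ p = Any.map here~⁻ (Any.map⁻ p)
  ... | inj₂ p = ⊥-elim (here≁there (proj₂ (Any.satisfied (Any.map⁻ p))))

  coverʳ : ∀ w → Any (w ~ᶠ_) b
  coverʳ w with Any.++⁻ (map here a) (cover (there w))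
  ... | inj₁ p = ⊥-elim (here≁there (swap (proj₂ (Any.satisfied (Any.map⁻ p)))))
  ... | inj₂ p = Any.map there~⁻ (Any.map⁻ p)

maximal-join⁺ : ∀ {t ts} {a : List (Vertex t)} {b : List (Any Vertex ts)} →
                Maximal _~_ a → Maximal _~ᶠ_ b → Maximal _~ᶠ_ (join a b)
maximal-join⁺ {t} {ts} {a} {b} (antiᵃ , coverᵃ) (antiᵇ , coverᵇ) =
  AllPairs.++⁺ (AllPairs.map⁺ (AllPairs.map (_∘ here~⁻) antiᵃ))
               (AllPairs.map⁺ (AllPairs.map (_∘ there~⁻) antiᵇ))
               (All.map⁺ (All.universal (λ _ → All.map⁺ (All.universal (λ _ → here≁there) b)) a))
  , λ { (here w)  → Any.++⁺ˡ (Any.map⁺ (Any.map (Sum.map here≼ here≼) (coverᵃ w)))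
      ; (there w) → Any.++⁺ʳ (map here a) (Any.map⁺ (Any.map (Sum.map there≼ there≼) (coverᵇ w))) }

-- Only the root is new, and any nonempty list covers it. A branch `t` must exist: over the empty
-- forest `[]` is maximal, yet it does not cover the root of the one-vertex tree.
maximal-below : ∀ {t ts} → Maximal (_~ᶠ_ {t ∷ ts}) ≐ Maximal _~_ ∘ map below
maximal-below {t = node _} = to , from
  where
  to : ∀ {l} → Maximal _~ᶠ_ l → Maximal _~_ (map below l)
  to (anti , cover) = AllPairs.map⁺ (AllPairs.map (_∘ below~⁻) anti) ,
    -- The cover of the root of `t` serves only to exhibit some member, which then lies below the
    -- new root.
    λ { root      → Any.map⁺ (Any.map (λ _ → inj₁ root≼) (cover (here root)))
      ; (below w) → Any.map⁺ (Any.map (Sum.map below≼ below≼) (cover w)) }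

  from : ∀ {l} → Maximal _~_ (map below l) → Maximal _~ᶠ_ l
  from (anti , cover) =
    AllPairs.map (_∘ Sum.map below≼ below≼) (AllPairs.map⁻ anti) ,
    λ w → Any.map below~⁻ (Any.map⁻ (cover (below w)))

maximal-[root] : ∀ {ts} → Maximal _~_ (root {ts} ∷ [])
maximal-[root] = [] ∷ [] , λ _ → here (inj₂ root≼)

¬maximal-root∷ : ∀ {ts v l} → ¬ Maximal _~_ (root {ts} ∷ v ∷ l)
¬maximal-root∷ ((root≁v ∷ _) ∷ _ , _) = root≁v (inj₁ root≼)

-- Recursion for the maximal antichains of trees and forests

maxAntichains : (T : Tree) → List (List (Vertex T))
maxAntichains T = filter (treeMaximal? T) (sublists (vertices T))

forestMaxAntichains : (ts : List Tree) → List (List (Any Vertex ts))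
forestMaxAntichains ts = filter (forestMaximal? ts) (sublists (forestVertices ts))

maxAntichains-node : ∀ t ts → maxAntichains (node (t ∷ ts))
                     ≡ map (map below) (forestMaxAntichains (t ∷ ts)) ++ (root ∷ []) ∷ []
maxAntichains-node t ts = begin
  filter max? (S ++ map (root ∷_) S)
    ≡⟨ filter-++ max? S _ ⟩
  filter max? S ++ filter max? (map (root ∷_) S)
    ≡⟨ cong₂ _++_ avoiding containing ⟩
  map (map below) (forestMaxAntichains (t ∷ ts)) ++ (root ∷ []) ∷ [] ∎
  where
  max? = treeMaximal? (node (t ∷ ts))
  W    = forestVertices (t ∷ ts)
  S    = sublists (map below W)

  avoiding : filter max? S ≡ map (map below) (forestMaxAntichains (t ∷ ts))
  avoiding = begin
    filter max? S                            ≡⟨ cong (filter max?) (sublists-map below W) ⟩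
    filter max? (map (map below) (sublists W))
      ≡⟨ map-filter (forestMaximal? (t ∷ ts)) max? (map below) maximal-below (sublists W) ⟨
    map (map below) (forestMaxAntichains (t ∷ ts)) ∎

  containing : filter max? (map (root ∷_) S) ≡ (root ∷ []) ∷ []
  containing = begin
    filter max? (map (root ∷_) S)
      -- Pulled back along `root ∷_`, the test accepts `[]` and rejects every nonempty list, as the
      -- root is comparable to all vertices.
      ≡⟨ map-filter (max? ∘ (root ∷_)) max? (root ∷_) ((λ p → p) , (λ p → p)) S ⟨
    map (root ∷_) (filter (max? ∘ (root ∷_)) S)
      ≡⟨ cong (map (root ∷_))
           (filter-sublists-[] (max? ∘ (root ∷_)) maximal-[root] ¬maximal-root∷ (map below W)) ⟩
    (root ∷ []) ∷ [] ∎

forestMaxAntichains-∷ : ∀ t ts → forestMaxAntichains (t ∷ ts)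
                        ≡ cartesianProductWith join (maxAntichains t) (forestMaxAntichains ts)
forestMaxAntichains-∷ t ts = begin
  filter max? (sublists (map here V ++ map there W))
    ≡⟨ cong (filter max?) (sublists-++ (map here V) (map there W)) ⟩
  filter max? (cartesianProductWith _++_ (sublists (map here V)) (sublists (map there W)))
    ≡⟨ cong (filter max?) (cong₂ (cartesianProductWith _++_) (sublists-map here V) (sublists-map there W)) ⟩
  filter max? (cartesianProductWith _++_ (map (map here) (sublists V)) (map (map there) (sublists W)))
    -- The identity map is inserted only to match the lemma that absorbs `map here` and `map there`
    -- into `join`; `map-id` removes it next.
    ≡⟨ cong (filter max?)
         (map-cartesianProductWith join _++_ (λ l → l) (map here) (map there) (λ _ _ → refl) (sublists V) (sublists W)) ⟨
  filter max? (map (λ l → l) (cartesianProductWith join (sublists V) (sublists W)))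
    ≡⟨ cong (filter max?) (map-id (cartesianProductWith join (sublists V) (sublists W))) ⟩
  filter max? (cartesianProductWith join (sublists V) (sublists W))
    ≡⟨ filter-cartesianProductWith (treeMaximal? t) (forestMaximal? ts) max? join
         maximal-join⁻ maximal-join⁺ (sublists V) (sublists W) ⟩
  cartesianProductWith join (maxAntichains t) (forestMaxAntichains ts) ∎
  where
  max? = forestMaximal? (t ∷ ts)
  V    = vertices t
  W    = forestVertices ts

-- Weights

single? : (t : Tree) → Dec (t ≡ node [])
single? (node [])      = yes refl
single? (node (_ ∷ _)) = no λ ()

-- With `τ` either `subtree` or `forestSubtree`, the exponents of trees and forests are treated at
-- once.
leaves : (A → Tree) → List A → ℕ
leaves τ l = length (filter (single? ∘ τ) l)

size : (A → Tree) → List A → ℕ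
size τ l = sum (map (λ a → ∣ τ a ∣ ∸ 1) l)

weight : (A → Tree) → List A → Term
weight τ l = 1ℤ , leaves τ l , size τ l

leaves-map : (τ : B → Tree) (f : A → B) → ∀ l → leaves τ (map f l) ≡ leaves (τ ∘ f) l
leaves-map τ f l = begin
  length (filter (single? ∘ τ) (map f l))
    ≡⟨ cong length (map-filter (single? ∘ τ ∘ f) (single? ∘ τ) f ((λ p → p) , (λ p → p)) l) ⟨
  length (map f (filter (single? ∘ τ ∘ f) l))
    ≡⟨ length-map f (filter (single? ∘ τ ∘ f) l) ⟩
  leaves (τ ∘ f) l ∎

leaves-++ : (τ : A → Tree) → ∀ l m → leaves τ (l ++ m) ≡ leaves τ l + leaves τ m
leaves-++ τ l m = trans (cong length (filter-++ (single? ∘ τ) l m)) (length-++ (filter (single? ∘ τ) l))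

size-map : (τ : B → Tree) (f : A → B) → ∀ l → size τ (map f l) ≡ size (τ ∘ f) l
size-map τ f l = cong sum (sym (map-∘ l))

size-++ : (τ : A → Tree) → ∀ l m → size τ (l ++ m) ≡ size τ l + size τ m
size-++ τ l m = trans (cong sum (map-++ _ l m)) (sum-++ (map _ l) _)

weight-map : (τ : B → Tree) (f : A → B) → ∀ l → weight τ (map f l) ≡ weight (τ ∘ f) l
weight-map τ f l = cong₂ (λ i j → 1ℤ , i , j) (leaves-map τ f l) (size-map τ f l)

-- A vertex keeps its subtree when its branch is put into a forest, so both exponents add up, as
-- they do under `·ᵗ`.
weight-join : ∀ {t ts} (a : List (Vertex t)) (b : List (Any Vertex ts)) →
              weight forestSubtree (join a b) ≡ weight subtree a ·ᵗ weight forestSubtree b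
weight-join a b = cong₂ (λ i j → 1ℤ , i , j)
  (trans (leaves-++ forestSubtree (map here a) (map there b))
         (cong₂ _+_ (leaves-map forestSubtree here a) (leaves-map forestSubtree there b)))
  (trans (size-++ forestSubtree (map here a) (map there b))
         (cong₂ _+_ (size-map forestSubtree here a) (size-map forestSubtree there b)))

X^ : ∀ n → X ^ n ≡ (1ℤ , n , 0) ∷ []
X^ zero    = refl
X^ (suc n) = cong (X ⊗_) (X^ n)

Y^ : ∀ n → Y ^ n ≡ (1ℤ , 0 , n) ∷ []
Y^ zero    = refl
Y^ (suc n) = cong (Y ⊗_) (Y^ n)

X^⊗Y^ : ∀ m n → X ^ m ⊗ Y ^ n ≡ (1ℤ , m , n) ∷ []
X^⊗Y^ m n = begin
  X ^ m ⊗ Y ^ n                 ≡⟨ cong₂ _⊗_ (X^ m) (Y^ n) ⟩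
  (1ℤ , m + 0 , n) ∷ []         ≡⟨ cong (λ k → (1ℤ , k , n) ∷ []) (+-identityʳ m) ⟩
  (1ℤ , m , n) ∷ []             ∎

mutual
  𝓟≡weights : ∀ T → 𝓟 T ≡ map (weight subtree) (maxAntichains T)
  -- By computation, `[]` is rejected and `root ∷ []` is kept, with weight `x`.
  𝓟≡weights (node [])          = refl
  𝓟≡weights T@(node (t ∷ ts)) = begin
    ∏𝓟 (t ∷ ts) ⊕ Y ^ (∣ T ∣ ∸ 1)
      ≡⟨ cong₂ _++_ (∏𝓟≡weights (t ∷ ts)) (Y^ (∣ T ∣ ∸ 1)) ⟩
    map (weight forestSubtree) M ++ (1ℤ , 0 , ∣ T ∣ ∸ 1) ∷ []
      -- `subtree ∘ below` computes to `forestSubtree`. The root is no leaf here, and its `size` is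
      -- a sum ending in `+ 0`.
      ≡⟨ cong₂ _++_ (map-cong (sym ∘ weight-map subtree below) M)
                    (cong (λ n → (1ℤ , 0 , n) ∷ []) (sym (+-identityʳ (∣ T ∣ ∸ 1)))) ⟩
    map (weight subtree ∘ map below) M ++ weight subtree (root {t ∷ ts} ∷ []) ∷ []
      ≡⟨ cong (_++ weight subtree (root {t ∷ ts} ∷ []) ∷ []) (map-∘ M) ⟩
    map (weight subtree) (map (map below) M) ++ weight subtree (root {t ∷ ts} ∷ []) ∷ []
      ≡⟨ map-++ (weight subtree) (map (map below) M) _ ⟨
    map (weight subtree) (map (map below) M ++ (root ∷ []) ∷ [])
      ≡⟨ cong (map (weight subtree)) (maxAntichains-node t ts) ⟨
    map (weight subtree) (maxAntichains T) ∎
    where M = forestMaxAntichains (t ∷ ts)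

  -- `⊗` is itself a cartesian product, and `weight-join` carries `join` to `·ᵗ`. The empty forest
  -- has `[]` as its one maximal antichain, of weight 1.
  ∏𝓟≡weights : ∀ ts → ∏𝓟 ts ≡ map (weight forestSubtree) (forestMaxAntichains ts)
  ∏𝓟≡weights []       = refl
  ∏𝓟≡weights (t ∷ ts) = begin
    𝓟 t ⊗ ∏𝓟 ts
      ≡⟨ cong₂ _⊗_ (𝓟≡weights t) (∏𝓟≡weights ts) ⟩
    map (weight subtree) M ⊗ map (weight forestSubtree) N
      ≡⟨ map-cartesianProductWith join _·ᵗ_ (weight forestSubtree) (weight subtree) (weight forestSubtree)
           weight-join M N ⟨
    map (weight forestSubtree) (cartesianProductWith join M N)
      ≡⟨ cong (map (weight forestSubtree)) (forestMaxAntichains-∷ t ts) ⟨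
    map (weight forestSubtree) (forestMaxAntichains (t ∷ ts)) ∎
    where
    M = maxAntichains t
    N = forestMaxAntichains ts

-- Comparison with the enumeration of index sets

≼-refl : ∀ {T} (v : Vertex T) → v ≼ v
≼ᶠ-refl : ∀ {ts} (v : Any Vertex ts) → v ≼ᶠ v
≼-refl root      = root≼
≼-refl (below v) = below≼ (≼ᶠ-refl v)
≼ᶠ-refl (here v)  = here≼ (≼-refl v)
≼ᶠ-refl (there v) = there≼ (≼ᶠ-refl v)

module _ {T : Tree} {A : VertexSet T} where

  private
    indices : List (Fin ∣ T ∣)
    indices = filter (_∈? A) (allFin ∣ T ∣)

    ∈-indices⁺ : ∀ {i} → i ∈ A → i ∈ˡ indices
    ∈-indices⁺ {i} = ∈-filter⁺ (_∈? A) (∈-allFin i)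

    ∈-indices⁻ : ∀ {i} → i ∈ˡ indices → i ∈ A
    ∈-indices⁻ = proj₂ ∘ ∈-filter⁻ (_∈? A) {xs = allFin ∣ T ∣}

  -- The entries of `indices` are distinct, and applying the hypothesis to both orders of a pair
  -- excludes both halves of `~`.
  antichain⇒allPairs : IsAntichain T A → AllPairs (λ u v → ¬ u ~ v) (members T A)
  antichain⇒allPairs anti = AllPairs.map⁺
    (AllPairs-unique (Unique.filter⁺ (_∈? A) (Unique.allFin⁺ ∣ T ∣))
      λ {i} {j} i∈ j∈ i≢j →
        Sum.[ anti i j (∈-indices⁻ i∈) (∈-indices⁻ j∈) i≢j
            , anti j i (∈-indices⁻ j∈) (∈-indices⁻ i∈) (i≢j ∘ sym) ]′)

  allPairs⇒antichain : AllPairs (λ u v → ¬ u ~ v) (members T A) → IsAntichain T A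
  allPairs⇒antichain anti i j i∈A j∈A i≢j i≼j =
    AllPairs-lookup {R = (λ u v → ¬ u ~ v) on vertex T} (_∘ swap) (AllPairs.map⁻ anti)
      (∈-indices⁺ i∈A) (∈-indices⁺ j∈A) i≢j (inj₁ i≼j)

  -- If `vertex T i` were comparable to no member, adjoining `i` to `A` would give a larger
  -- antichain.
  maximalAntichain⇒maximal : IsMaximalAntichain T A → Maximal _~_ (members T A)
  maximalAntichain⇒maximal (anti , max) = antichain⇒allPairs anti , cover
    where
    coverIndex : ∀ i → Any (vertex T i ~_) (members T A)
    coverIndex i with Any.any? (vertex T i ~?_) (members T A)
    ... | yes p = p
    ... | no ¬p = ⊥-elim (max (A ∪ ⁅ i ⁆) anti′
                    (p⊆p∪q ⁅ i ⁆ , i , q⊆p∪q A ⁅ i ⁆ (x∈⁅x⁆ i) ,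
                     -- The extension is strict: with `i` in `A`, reflexivity would contradict `i≁`.
                     λ i∈A → i≁ i∈A (inj₁ (≼-refl (vertex T i)))))
      where
      i≁ : ∀ {j} → j ∈ A → ¬ vertex T i ~ vertex T j
      i≁ j∈A i~j = ¬p (lose (∈-map⁺ (vertex T) (∈-indices⁺ j∈A)) i~j)

      anti′ : IsAntichain T (A ∪ ⁅ i ⁆)
      anti′ j k j∈ k∈ j≢k j≼k with x∈p∪q⁻ A ⁅ i ⁆ j∈ | x∈p∪q⁻ A ⁅ i ⁆ k∈
      ... | inj₁ j∈A | inj₁ k∈A = anti j k j∈A k∈A j≢k j≼k
      ... | inj₁ j∈A | inj₂ k∈i with refl ← x∈⁅y⁆⇒x≡y i k∈i = i≁ j∈A (inj₂ j≼k)
      ... | inj₂ j∈i | inj₁ k∈A with refl ← x∈⁅y⁆⇒x≡y i j∈i = i≁ k∈A (inj₁ j≼k)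
      ... | inj₂ j∈i | inj₂ k∈i = j≢k (trans (x∈⁅y⁆⇒x≡y i j∈i) (sym (x∈⁅y⁆⇒x≡y i k∈i)))

    cover : ∀ w → Any (w ~_) (members T A)
    -- Every vertex is the entry of `vertices T` at the index given by its membership proof.
    cover w = subst (λ v → Any (v ~_) (members T A)) (sym (Any.lookup-index (∈-vertices w)))
                    (coverIndex (Any.index (∈-vertices w)))

  -- An index in `B` but not in `A` is comparable to some member of `A`, which is a different
  -- element of the antichain `B`.
  maximal⇒maximalAntichain : Maximal _~_ (members T A) → IsMaximalAntichain T A
  maximal⇒maximalAntichain (anti , cover) = allPairs⇒antichain anti , max
    where
    max : ∀ B → IsAntichain T B → ¬ (A ⊂ B)
    max B antiB (A⊆B , i , i∈B , i∉A) with find (cover (vertex T i))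
    ... | _ , v∈ , i~v with ∈-map⁻ (vertex T) v∈
    ... | j , j∈ , refl =
      Sum.[ antiB i j i∈B j∈B i≢j , antiB j i j∈B i∈B (i≢j ∘ sym) ]′ i~v
      where
      j∈A = ∈-indices⁻ j∈
      j∈B = A⊆B j∈A
      i≢j : i ≢ j
      i≢j refl = i∉A j∈A

members-𝓐 : ∀ T → map (members T) (𝓐 T) ≡ maxAntichains T
members-𝓐 T = begin
  map (members T) (filter (isMaximalAntichain? T) (subsets ∣ T ∣))
    ≡⟨ map-filter (isMaximalAntichain? T) (treeMaximal? T) (members T)
         ((λ {A} → maximalAntichain⇒maximal {T} {A}) , (λ {A} → maximal⇒maximalAntichain {T} {A})) (subsets ∣ T ∣) ⟩
  filter (treeMaximal? T) (map (members T) (subsets ∣ T ∣))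
    ≡⟨ cong (filter (treeMaximal? T)) (map-select-subsets (vertices T)) ⟩
  maxAntichains T ∎

-- `isLeaf?` and `single? ∘ subtree` are different deciders of one predicate, so their filters
-- agree.
ℓ≡leaves : ∀ T A → ℓ T A ≡ leaves subtree (members T A)
ℓ≡leaves T A = cong length (filter-≐ isLeaf? (single? ∘ subtree) ((λ p → p) , (λ p → p)) (members T A))

⨁-monomials : {f : A → Poly} {g : A → Term} → (∀ x → f x ≡ g x ∷ []) →
              ∀ xs → ⨁ (map f xs) ≡ map g xs
⨁-monomials eq []       = refl
⨁-monomials eq (x ∷ xs) = cong₂ _++_ (eq x) (⨁-monomials eq xs)

L≡weights : ∀ T → L T ≡ map (weight subtree) (maxAntichains T)
L≡weights T = begin
  L T
    -- `s T A` unfolds to `size subtree (members T A)`, so only the leaf count has to be rewritten.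
    ≡⟨ ⨁-monomials (λ A → trans (X^⊗Y^ (ℓ T A) (s T A)) (cong (λ n → (1ℤ , n , s T A) ∷ []) (ℓ≡leaves T A))) (𝓐 T) ⟩
  map (weight subtree ∘ members T) (𝓐 T)
    ≡⟨ map-∘ (𝓐 T) ⟩
  map (weight subtree) (map (members T) (𝓐 T))
    ≡⟨ cong (map (weight subtree)) (members-𝓐 T) ⟩
  map (weight subtree) (maxAntichains T) ∎

theorem2p9 : (T : Tree) → 𝓟 T ≈ L T
theorem2p9 T i j = cong (λ p → coeff p i j) (trans (𝓟≡weights T) (sym (L≡weights T)))
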